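{- Let $G$ be any graph with $r$ vertices and $m$ edges. Let $S$ be a set of positive integers with $|S|=m+2$. Then any $S$-partial labeling of $G$ that satisfies the property that no more than $\lceil r/2\rceil$ vertices have the same positive weight has a completion that also satisfies this property.
   Context: All graphs are finite, undirected and simple. For a graph $G=(V,E)$ and a set $S$ of positive integers, an $S$-partial labeling of $G$ is an assignment of distinct labels from $S$ to some of the edges of $G$ ($|S|>|E|$ is allowed). Given a partial labeling, the weight of a vertex $v$ is the sum of the labels of those edges incident with $v$ that received a label. A completion of an $S$-partial labeling is an assignment of distinct unused labels from $S$ to all the remaining non-labeled edges of $G$.
   Formalization: The graph with r = 2 vertices and m = 1 edge is excluded, since there the claim fails: the empty labeling has the property, but every completion gives both vertices the same positive weight while ⌈2/2⌉ = 1. -}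

module Defs where

open import Data.Nat using (ℕ; _≤_; _<_; ⌈_/2⌉)
import Data.Nat.Properties as ℕ
open import Data.Fin as Fin using (Fin)
import Data.Fin.Properties as Fin
open import Data.List using (List; length; filter; mapMaybe; allFin)
open import Data.Nat.ListAction using (sum)
open import Data.List.Membership.Propositional using (_∈_)
open import Data.List.Relation.Unary.All using (All)
open import Data.List.Relation.Unary.Unique.Propositional using (Unique)
open import Data.Maybe using (Maybe; just)
open import Data.Product using (_×_)
open import Data.Sum using (_⊎_)
open import Function using (_∘_)
open import Relation.Binary.PropositionalEquality using (_≡_)
open import Relation.Nullary using (¬_)
open import Relation.Nullary.Decidable using (Dec; _⊎-dec_)

-- The edge set is an enumeration, without repetition, of two-element subsets
-- of the vertex set Fin r.  A subset {u , v} is stored with its smaller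
-- element first, so strictness rules out loops and `simple` rules out
-- parallel edges.
record Graph (r m : ℕ) : Set where
  field
    end₁ end₂ : Fin m → Fin r
    ordered   : ∀ e → end₁ e Fin.< end₂ e
    simple    : ∀ {e f} → end₁ e ≡ end₁ f → end₂ e ≡ end₂ f → e ≡ f

open Graph public

Incident : ∀ {r m} → Graph r m → Fin r → Fin m → Set
Incident G v e = v ≡ end₁ G e ⊎ v ≡ end₂ G e

incident? : ∀ {r m} (G : Graph r m) v e → Dec (Incident G v e)
incident? G v e = (v Fin.≟ end₁ G e) ⊎-dec (v Fin.≟ end₂ G e)

-- A finite set of positive integers of cardinality k, as a duplicate-free list.
record IsPositiveSet (S : List ℕ) (k : ℕ) : Set where
  field
    unique      : Unique S
    positive    : All (0 <_) S
    cardinality : length S ≡ k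

-- `nothing` marks an edge that has not received a label.
record IsPartialLabeling {m : ℕ} (S : List ℕ) (ℓ : Fin m → Maybe ℕ) : Set where
  field
    fromS    : ∀ {e a} → ℓ e ≡ just a → a ∈ S
    distinct : ∀ {e f a} → ℓ e ≡ just a → ℓ f ≡ just a → e ≡ f

-- Distinctness of c over all edges says both that the newly assigned labels
-- are pairwise distinct and that none of them is already used by ℓ.
record IsCompletion {m : ℕ} (S : List ℕ) (ℓ : Fin m → Maybe ℕ) (c : Fin m → ℕ) : Set where
  field
    extends    : ∀ {e a} → ℓ e ≡ just a → c e ≡ a
    isLabeling : IsPartialLabeling S (just ∘ c)

weight : ∀ {r m} → Graph r m → (Fin m → Maybe ℕ) → Fin r → ℕ
weight {m = m} G ℓ v = sum (mapMaybe ℓ (filter (incident? G v) (allFin m)))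

#verticesOfWeight : ∀ {r m} → Graph r m → (Fin m → Maybe ℕ) → ℕ → ℕ
#verticesOfWeight {r = r} G ℓ w = length (filter (λ v → weight G ℓ v ℕ.≟ w) (allFin r))

HalfBounded : ∀ {r m} → Graph r m → (Fin m → Maybe ℕ) → Set
HalfBounded {r = r} G ℓ = ∀ w → 0 < w → #verticesOfWeight G ℓ w ≤ ⌈ r /2⌉

-- A graph with two vertices and one edge is K₂.  It has to be excluded: the
-- empty labeling of K₂ is HalfBounded, but in any full labeling both vertices
-- carry the same positive weight, while ⌈ 2 /2⌉ = 1.
NotK₂ : ℕ → ℕ → Set
NotK₂ r m = ¬ (r ≡ 2 × m ≡ 1)

{-# OPTIONS --safe #-}
module Submission where

-- Label the remaining edges one at a time.  When the edge {u , v} is about to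
-- be labeled, at least three labels are unused, and at most two of them are
-- bad.  Let f w be the number of vertices other than u and v of weight w, let
-- h = ⌈ r /2⌉, and let g be the current weight.  If g u = g v, then a is bad
-- only if f (a + g u) ≥ h - 1; three such a would need 3 (h - 1) ≤ r - 2
-- ≤ 2 (h - 1), so h ≤ 1, which leaves only K₂.  If g u ≠ g v, then a is bad
-- only if f (a + g u) ≥ h or f (a + g v) ≥ h; among three bad labels two are
-- bad for the same endpoint, which would need 2 h ≤ r - 2.

open import Data.Nat using (ℕ; suc; _+_; _≤_; _<_; s≤s; z≤n; _≤?_; ⌈_/2⌉; _≟_)
open import Data.Nat.Properties
open import Data.Nat.ListAction using (sum)
open import Data.Nat.Solver using (module +-*-Solver)
open import Data.Fin as Fin using (Fin)
import Data.Fin.Properties as Fin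
open import Data.List using (List; []; _∷_; length; filter; mapMaybe; allFin)
open import Data.List.Properties using (length-mapMaybe; filter-accept; filter-reject; mapMaybe-cong; length-tabulate)
open import Data.List.Membership.Propositional using (_∈_; _∉_)
open import Data.List.Membership.Propositional.Properties using (∈-allFin; ∈-filter⁺; ∈-filter⁻)
open import Data.List.Membership.DecPropositional _≟_ using (_∈?_)
open import Data.List.Relation.Unary.Any using (here; there)
open import Data.List.Relation.Unary.All as All using (All; []; _∷_)
open import Data.List.Relation.Unary.AllPairs using ([]; _∷_)
open import Data.List.Relation.Unary.Unique.Propositional using (Unique)
open import Data.List.Relation.Unary.Unique.Propositional.Properties using (allFin⁺; filter⁺)
open import Data.List.Relation.Binary.Permutation.Propositional using (_↭_; refl; prep; swap; trans; ↭-sym)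
open import Data.List.Relation.Binary.Permutation.Propositional.Properties using (All-resp-↭; ∈-resp-↭; ↭-length; filter-↭)
open import Data.Maybe using (Maybe; just; nothing)
open import Data.Maybe.Properties using (just-injective)
open import Data.Product using (Σ; ∃; _×_; _,_; proj₁; proj₂)
open import Data.Sum using (_⊎_; inj₁; inj₂)
open import Data.Vec.Functional using (updateAt)
open import Data.Vec.Functional.Properties using (updateAt-updates; updateAt-minimal)
open import Function using (_∘_; const)
open import Relation.Binary.PropositionalEquality as ≡ using (_≡_; _≢_; _≗_; refl; sym; cong; subst; ≢-sym)
open import Relation.Nullary using (¬_; yes; no; contradiction)
open import Defs

-- Duplicate-free lists and the pigeonhole principle.

extract : ∀ {A : Set} {x : A} {xs} → Unique xs → x ∈ xs →
          ∃ λ ys → xs ↭ x ∷ ys × All (x ≢_) ys × Unique ys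
extract (x∉xs ∷ !xs) (here refl) = _ , refl , x∉xs , !xs
extract (y∉xs ∷ !xs) (there x∈xs) with extract !xs x∈xs
... | ys , σ , x∉ys , !ys with All-resp-↭ σ y∉xs
...   | y≢x ∷ y∉ys =
  _ , trans (prep _ σ) (swap _ _ refl) , ≢-sym y≢x ∷ x∉ys , y∉ys ∷ !ys

-- Induction on `ys`. A head `y` that occurs in `xs` is removed from both lists; as `xs` is
-- duplicate-free, `y` does not occur in the remainder, so the element found there also differs from
-- `y`.
pigeonhole : ∀ {xs ys : List ℕ} → Unique xs → length ys < length xs →
             ∃ λ x → x ∈ xs × x ∉ ys
pigeonhole {x ∷ _} {[]}     _   _      = x , here refl , λ ()
pigeonhole {xs}    {y ∷ ys} !xs ∣y∷ys∣< with y ∈? xs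
... | no y∉xs with pigeonhole !xs (<-trans (n<1+n _) ∣y∷ys∣<)
...   | x , x∈xs , x∉ys = x , x∈xs , λ where
  (here refl)  → y∉xs x∈xs
  (there x∈ys) → x∉ys x∈ys
pigeonhole {xs} {y ∷ ys} !xs ∣y∷ys∣< | yes y∈xs with extract !xs y∈xs
... | zs , σ , y∉zs , !zs
    with pigeonhole !zs (≤-pred (subst (_ <_) (↭-length σ) ∣y∷ys∣<))
...   | x , x∈zs , x∉ys = x , ∈-resp-↭ (↭-sym σ) (there x∈zs) , λ where
  (here refl)  → All.lookup y∉zs x∈zs refl
  (there x∈ys) → x∉ys x∈ys

-- Counting the list elements with a given value.

module _ {A : Set} where

  count : (A → ℕ) → ℕ → List A → ℕ
  count f w xs = length (filter (λ x → f x ≟ w) xs)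

  -- Allows the vertex list to be rearranged with the two ends of the current edge in front.
  count-↭ : ∀ f w {xs ys} → xs ↭ ys → count f w xs ≡ count f w ys
  count-↭ f w σ = ↭-length (filter-↭ (λ x → f x ≟ w) σ)

  count-accept : ∀ f {w x} xs → f x ≡ w → count f w (x ∷ xs) ≡ suc (count f w xs)
  count-accept f {w} xs fx≡w = cong length (filter-accept (λ x → f x ≟ w) fx≡w)

  count-reject : ∀ f {w x} xs → f x ≢ w → count f w (x ∷ xs) ≡ count f w xs
  count-reject f {w} xs fx≢w = cong length (filter-reject (λ x → f x ≟ w) fx≢w)

  count-∷-≤ : ∀ f w x xs → count f w (x ∷ xs) ≤ suc (count f w xs)
  count-∷-≤ f w x xs with f x ≟ w
  ... | yes p = ≤-reflexive (count-accept f xs p)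
  ... | no  p = m≤n⇒m≤1+n (≤-reflexive (count-reject f xs p))

  count-≤-∷ : ∀ f w x xs → count f w xs ≤ count f w (x ∷ xs)
  count-≤-∷ f w x xs with f x ≟ w
  ... | yes p = ≤-trans (n≤1+n _) (≤-reflexive (sym (count-accept f xs p)))
  ... | no  p = ≤-reflexive (sym (count-reject f xs p))

  count-cong : ∀ f g w {xs} → All (λ x → f x ≡ g x) xs → count f w xs ≡ count g w xs
  count-cong f g w [] = refl
  count-cong f g w {x ∷ xs} (fx≡gx ∷ f≗g) with g x ≟ w
  ... | yes p rewrite count-accept g xs p | count-accept f xs (≡.trans fx≡gx p) =
    cong suc (count-cong f g w f≗g)
  ... | no  p rewrite count-reject g xs p | count-reject f xs (p ∘ ≡.trans (sym fx≡gx)) =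
    count-cong f g w f≗g

  -- An element has a single value under `f`, so it enters at most one of the three counts.
  count-disjoint₃ : ∀ f {a b c} xs → a ≢ b → a ≢ c → b ≢ c →
                    count f a xs + count f b xs + count f c xs ≤ length xs
  count-disjoint₃ f [] _ _ _ = z≤n
  count-disjoint₃ f {a} {b} {c} (x ∷ xs) a≢b a≢c b≢c
    with ih ← count-disjoint₃ f xs a≢b a≢c b≢c | f x ≟ a | f x ≟ b | f x ≟ c
  ... | yes p | yes q | _     = contradiction (≡.trans (sym p) q) a≢b
  ... | yes p | no  _ | yes q = contradiction (≡.trans (sym p) q) a≢c
  ... | no  _ | yes p | yes q = contradiction (≡.trans (sym p) q) b≢c
  ... | yes p | no  q | no  s
    rewrite count-accept f xs p | count-reject f xs q | count-reject f xs s = s≤s ih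
  ... | no  p | yes q | no  s
    rewrite count-reject f xs p | count-accept f xs q | count-reject f xs s
          | +-suc (count f a xs) (count f b xs) = s≤s ih
  ... | no  p | no  q | yes s
    rewrite count-reject f xs p | count-reject f xs q | count-accept f xs s
          | +-suc (count f a xs + count f b xs) (count f c xs) = s≤s ih
  ... | no  p | no  q | no  s
    rewrite count-reject f xs p | count-reject f xs q | count-reject f xs s = m≤n⇒m≤1+n ih

  count-disjoint₂ : ∀ f {a b} xs → a ≢ b → count f a xs + count f b xs ≤ length xs
  count-disjoint₂ f [] _ = z≤n
  count-disjoint₂ f {a} {b} (x ∷ xs) a≢b
    with ih ← count-disjoint₂ f xs a≢b | f x ≟ a | f x ≟ b
  ... | yes p | yes q = contradiction (≡.trans (sym p) q) a≢b
  ... | yes p | no  q rewrite count-accept f xs p | count-reject f xs q = s≤s ih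
  ... | no  p | yes q
    rewrite count-reject f xs p | count-accept f xs q
          | +-suc (count f a xs) (count f b xs) = s≤s ih
  ... | no  p | no  q rewrite count-reject f xs p | count-reject f xs q = m≤n⇒m≤1+n ih

-- Bad labels for a single edge.

-- Adding the three lower bounds gives 3 (k - 1) ≤ n ≤ 2 k - 2, which forces k ≤ 1.
¬three-near-half : ∀ {k x y z n} → 2 ≤ k → 2 + n ≤ k + k → x + y + z ≤ n →
                   k ≤ suc x → k ≤ suc y → ¬ k ≤ suc z
-- From here on `k` is the original bound less two, so each of `x`, `y`, `z` is at least `suc k`.
¬three-near-half {suc (suc k)} {x} {y} {z} {n} (s≤s (s≤s z≤n)) 2+n≤ x+y+z≤n
                 (s≤s kx) (s≤s ky) (s≤s kz) = <-irrefl refl (begin-strict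
  suc (suc (k + k))           <⟨ m≤m+n _ k ⟩
  suc (suc (suc (k + k + k))) ≡⟨ solve 1 (λ i → con 3 :+ (i :+ i :+ i) := con 1 :+ i :+ (con 1 :+ i) :+ (con 1 :+ i)) refl k ⟩
  suc k + suc k + suc k       ≤⟨ +-mono-≤ (+-mono-≤ kx ky) kz ⟩
  x + y + z                   ≤⟨ x+y+z≤n ⟩
  n                           ≤⟨ ≤-pred (≤-pred 2+n≤) ⟩
  k + suc (suc k)             ≡⟨ solve 1 (λ i → i :+ (con 2 :+ i) := con 2 :+ (i :+ i)) refl k ⟩
  suc (suc (k + k))           ∎)
  where
  open ≤-Reasoning
  open +-*-Solver

-- raise a is the weight function once the edge {u , v} has received label a.
module Raise {A : Set} {vs L : List A} {u v : A} (σ : vs ↭ u ∷ v ∷ L)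
             (u∉L : All (u ≢_) L) (v∉L : All (v ≢_) L)
             (g : A → ℕ) (raise : ℕ → A → ℕ)
             (raise-u : ∀ a → raise a u ≡ a + g u)
             (raise-v : ∀ a → raise a v ≡ a + g v)
             (raise-other : ∀ a {x} → u ≢ x → v ≢ x → raise a x ≡ g x)
             (h : ℕ) (∣vs∣≤2h : length vs ≤ h + h) where

  Bounded : (A → ℕ) → Set
  Bounded f = ∀ w → 0 < w → count f w vs ≤ h

  2+∣L∣≤2h : 2 + length L ≤ h + h
  2+∣L∣≤2h = subst (_≤ h + h) (↭-length σ) ∣vs∣≤2h

  -- For an end of weight `t`, different labels lead to different weights. The two counts then
  -- concern disjoint parts of `L`, giving 2 h ≤ |L|, against `2+∣L∣≤2h`.
  ¬two-bad : ∀ {a b} t → a ≢ b → h ≤ count g (a + t) L → ¬ h ≤ count g (b + t) L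
  ¬two-bad {a} {b} t a≢b ha hb = <-irrefl refl (begin-strict
    length L                              <⟨ n<1+n _ ⟩
    1 + length L                          ≤⟨ n≤1+n _ ⟩
    2 + length L                          ≤⟨ 2+∣L∣≤2h ⟩
    h + h                                 ≤⟨ +-mono-≤ ha hb ⟩
    count g (a + t) L + count g (b + t) L ≤⟨ count-disjoint₂ g L (a≢b ∘ +-cancelʳ-≡ t a b) ⟩
    length L                              ∎)
    where open ≤-Reasoning

  count-raise-L : ∀ a w → count (raise a) w L ≡ count g w L
  count-raise-L a w =
    count-cong (raise a) g w (All.zipWith (λ (u≢x , v≢x) → raise-other a u≢x v≢x) (u∉L , v∉L))

  module _ (g-bounded : Bounded g) where

    -- Neither end reaches weight `w`, and the other weights stay as they were, so the count at `w`
    -- cannot have grown.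
    bounded-elsewhere : ∀ a w → 0 < w → a + g u ≢ w → a + g v ≢ w →
                        count (raise a) w (u ∷ v ∷ L) ≤ h
    bounded-elsewhere a w 0<w u≢ v≢ = begin
      count (raise a) w (u ∷ v ∷ L) ≡⟨ count-reject (raise a) (v ∷ L) (u≢ ∘ ≡.trans (sym (raise-u a))) ⟩
      count (raise a) w (v ∷ L)     ≡⟨ count-reject (raise a) L (v≢ ∘ ≡.trans (sym (raise-v a))) ⟩
      count (raise a) w L           ≡⟨ count-raise-L a w ⟩
      count g w L                   ≤⟨ count-≤-∷ g w v L ⟩
      count g w (v ∷ L)             ≤⟨ count-≤-∷ g w u (v ∷ L) ⟩
      count g w (u ∷ v ∷ L)         ≡⟨ count-↭ g w σ ⟨
      count g w vs                  ≤⟨ g-bounded w 0<w ⟩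
      h                             ∎
      where open ≤-Reasoning

    -- Both ends move to the weight `a + g u` and add two to the count over `L` there; any other
    -- weight falls under `bounded-elsewhere`.
    bounded-of-equal : g u ≡ g v → ∀ a →
                       Bounded (raise a) ⊎ h ≤ suc (count g (a + g u) L)
    bounded-of-equal gu≡gv a with h ≤? suc (count g (a + g u) L)
    ... | yes bad = inj₂ bad
    ... | no  ok  = inj₁ λ w 0<w → subst (_≤ h) (sym (count-↭ (raise a) w σ)) (bound w 0<w)
      where
      open ≤-Reasoning
      bound : ∀ w → 0 < w → count (raise a) w (u ∷ v ∷ L) ≤ h
      bound w 0<w with a + g u ≟ w
      ... | no  u≢   = bounded-elsewhere a w 0<w u≢ (u≢ ∘ ≡.trans (cong (a +_) gu≡gv))
      ... | yes refl = begin
        count (raise a) w (u ∷ v ∷ L)     ≤⟨ count-∷-≤ (raise a) w u (v ∷ L) ⟩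
        suc (count (raise a) w (v ∷ L))   ≤⟨ s≤s (count-∷-≤ (raise a) w v L) ⟩
        suc (suc (count (raise a) w L))   ≡⟨ cong (suc ∘ suc) (count-raise-L a w) ⟩
        -- The failure of `h ≤ suc n` amounts to n + 2 ≤ h, which leaves room for both ends.
        suc (suc (count g w L))           ≤⟨ ≰⇒> ok ⟩
        h                                 ∎

    -- The ends move to different weights and each adds only one to a count over `L`, so the
    -- threshold is `h` instead of h - 1.
    bounded-of-distinct : g u ≢ g v → ∀ a →
      Bounded (raise a) ⊎ h ≤ count g (a + g u) L ⊎ h ≤ count g (a + g v) L
    bounded-of-distinct gu≢gv a with h ≤? count g (a + g u) L | h ≤? count g (a + g v) L
    ... | yes bad | _       = inj₂ (inj₁ bad)
    ... | no  _   | yes bad = inj₂ (inj₂ bad)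
    ... | no  ok₁ | no  ok₂ =
      inj₁ λ w 0<w → subst (_≤ h) (sym (count-↭ (raise a) w σ)) (bound w 0<w)
      where
      open ≤-Reasoning
      bound : ∀ w → 0 < w → count (raise a) w (u ∷ v ∷ L) ≤ h
      bound w 0<w with a + g u ≟ w | a + g v ≟ w
      ... | no  u≢   | no  v≢   = bounded-elsewhere a w 0<w u≢ v≢
      ... | yes u≡   | yes v≡   = contradiction (+-cancelˡ-≡ a _ _ (≡.trans u≡ (sym v≡))) gu≢gv
      ... | yes refl | no  v≢   = begin
        count (raise a) w (u ∷ v ∷ L)   ≤⟨ count-∷-≤ (raise a) w u (v ∷ L) ⟩
        suc (count (raise a) w (v ∷ L)) ≡⟨ cong suc (count-reject (raise a) L (v≢ ∘ ≡.trans (sym (raise-v a)))) ⟩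
        suc (count (raise a) w L)       ≡⟨ cong suc (count-raise-L a w) ⟩
        suc (count g w L)               ≤⟨ ≰⇒> ok₁ ⟩
        h                               ∎
      ... | no  u≢   | yes refl = begin
        count (raise a) w (u ∷ v ∷ L)   ≡⟨ count-reject (raise a) (v ∷ L) (u≢ ∘ ≡.trans (sym (raise-u a))) ⟩
        count (raise a) w (v ∷ L)       ≤⟨ count-∷-≤ (raise a) w v L ⟩
        suc (count (raise a) w L)       ≡⟨ cong suc (count-raise-L a w) ⟩
        suc (count g w L)               ≤⟨ ≰⇒> ok₂ ⟩
        h                               ∎

    one-of-three : 2 ≤ h → ∀ a b c → a ≢ b → a ≢ c → b ≢ c →
                   Bounded (raise a) ⊎ Bounded (raise b) ⊎ Bounded (raise c)
    one-of-three 2≤h a b c a≢b a≢c b≢c with g u ≟ g v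
    ... | yes gu≡gv
        with bounded-of-equal gu≡gv a | bounded-of-equal gu≡gv b | bounded-of-equal gu≡gv c
    ...   | inj₁ ok | _       | _       = inj₁ ok
    ...   | inj₂ _  | inj₁ ok | _       = inj₂ (inj₁ ok)
    ...   | inj₂ _  | inj₂ _  | inj₁ ok = inj₂ (inj₂ ok)
    ...   | inj₂ x  | inj₂ y  | inj₂ z  =
      contradiction z (¬three-near-half 2≤h 2+∣L∣≤2h
        (count-disjoint₃ g L (shift a≢b) (shift a≢c) (shift b≢c)) x y)
      where
      shift : ∀ {i j} → i ≢ j → i + g u ≢ j + g u
      shift i≢j = i≢j ∘ +-cancelʳ-≡ (g u) _ _
    one-of-three 2≤h a b c a≢b a≢c b≢c | no gu≢gv
        with bounded-of-distinct gu≢gv a | bounded-of-distinct gu≢gv b | bounded-of-distinct gu≢gv c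
    ...   | inj₁ ok       | _             | _             = inj₁ ok
    ...   | inj₂ _        | inj₁ ok       | _             = inj₂ (inj₁ ok)
    ...   | inj₂ _        | inj₂ _        | inj₁ ok       = inj₂ (inj₂ ok)
    -- Three bad labels are shared between two ends, so in every case two of them are bad for the
    -- same end.
    ...   | inj₂ (inj₁ x) | inj₂ (inj₁ y) | inj₂ _        = contradiction y (¬two-bad _ a≢b x)
    ...   | inj₂ (inj₁ x) | inj₂ (inj₂ _) | inj₂ (inj₁ z) = contradiction z (¬two-bad _ a≢c x)
    ...   | inj₂ (inj₁ _) | inj₂ (inj₂ y) | inj₂ (inj₂ z) = contradiction z (¬two-bad _ b≢c y)
    ...   | inj₂ (inj₂ _) | inj₂ (inj₁ y) | inj₂ (inj₁ z) = contradiction z (¬two-bad _ b≢c y)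
    ...   | inj₂ (inj₂ x) | inj₂ (inj₁ _) | inj₂ (inj₂ z) = contradiction z (¬two-bad _ a≢c x)
    ...   | inj₂ (inj₂ x) | inj₂ (inj₂ y) | inj₂ _        = contradiction y (¬two-bad _ a≢b x)

-- Updating a labeling at one edge.

infixl 6 _[_≔_]
_[_≔_] : ∀ {m} → (Fin m → Maybe ℕ) → Fin m → ℕ → Fin m → Maybe ℕ
ℓ [ e ≔ a ] = updateAt ℓ e (const (just a))

module _ {m : ℕ} (ℓ : Fin m → Maybe ℕ) where

  mapMaybe-update-∉ : ∀ {e a es} → All (e ≢_) es →
                      mapMaybe (ℓ [ e ≔ a ]) es ≡ mapMaybe ℓ es
  mapMaybe-update-∉ [] = refl
  mapMaybe-update-∉ {e} {a} {f ∷ es} (e≢f ∷ e∉es)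
    rewrite updateAt-minimal f e {const (just a)} ℓ (≢-sym e≢f) with ℓ f
  ... | just b  = cong (b ∷_) (mapMaybe-update-∉ e∉es)
  ... | nothing = mapMaybe-update-∉ e∉es

  -- The edge `e` contributed nothing before, and uniqueness makes the new label enter the sum
  -- exactly once.
  sum-update-∈ : ∀ {e a es} → ℓ e ≡ nothing → Unique es → e ∈ es →
                 sum (mapMaybe (ℓ [ e ≔ a ]) es) ≡ a + sum (mapMaybe ℓ es)
  sum-update-∈ {e} {a} ℓe (e∉es ∷ _) (here refl)
    rewrite updateAt-updates e {const (just a)} ℓ | ℓe =
    cong (λ xs → a + sum xs) (mapMaybe-update-∉ e∉es)
  sum-update-∈ {e} {a} {f ∷ es} ℓe (f∉es ∷ !es) (there e∈es)
    rewrite updateAt-minimal f e {const (just a)} ℓ (All.lookup f∉es e∈es) with ℓ f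
  ... | nothing = sum-update-∈ ℓe !es e∈es
  ... | just b  = begin
    b + sum (mapMaybe (ℓ [ e ≔ a ]) es) ≡⟨ cong (b +_) (sum-update-∈ ℓe !es e∈es) ⟩
    b + (a + sum (mapMaybe ℓ es))       ≡⟨ solve 3 (λ x y z → x :+ (y :+ z) := y :+ (x :+ z)) refl b a _ ⟩
    a + (b + sum (mapMaybe ℓ es))       ∎
    where
    open ≡.≡-Reasoning
    open +-*-Solver

  -- An unlabeled edge yields no label, so the inequality is strict. Over all edges this means fewer
  -- than `m` labels are used, leaving at least three of m + 2.
  length-mapMaybe-< : ∀ {e es} → ℓ e ≡ nothing → e ∈ es →
                      length (mapMaybe ℓ es) < length es
  length-mapMaybe-< {es = _ ∷ es} ℓe (here refl) rewrite ℓe = s≤s (length-mapMaybe ℓ es)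
  length-mapMaybe-< {es = f ∷ _} ℓe (there e∈es) with ℓ f
  ... | just _  = s≤s (length-mapMaybe-< ℓe e∈es)
  ... | nothing = m<n⇒m<1+n (length-mapMaybe-< ℓe e∈es)

  ∈-mapMaybe : ∀ {f b es} → ℓ f ≡ just b → f ∈ es → b ∈ mapMaybe ℓ es
  ∈-mapMaybe ℓf (here refl) rewrite ℓf = here refl
  ∈-mapMaybe {es = f ∷ _} ℓf (there f∈es) with ℓ f
  ... | just _  = there (∈-mapMaybe ℓf f∈es)
  ... | nothing = ∈-mapMaybe ℓf f∈es

  module _ {r : ℕ} (G : Graph r m) where

    weight-incident : ∀ {e a v} → ℓ e ≡ nothing → Incident G v e →
                      weight G (ℓ [ e ≔ a ]) v ≡ a + weight G ℓ v
    weight-incident {e} {v = v} ℓe inc =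
      sum-update-∈ ℓe (filter⁺ (incident? G v) (allFin⁺ m))
                   (∈-filter⁺ (incident? G v) (∈-allFin e) inc)

    weight-¬incident : ∀ {e a v} → ¬ Incident G v e →
                       weight G (ℓ [ e ≔ a ]) v ≡ weight G ℓ v
    weight-¬incident {e} {v = v} ¬inc =
      cong sum (mapMaybe-update-∉ {es = filter (incident? G v) (allFin m)} (All.tabulate λ where
        f∈ refl → ¬inc (proj₂ (∈-filter⁻ (incident? G v) {xs = allFin m} f∈))))

-- Needed because the final labeling `just ∘ c` is known to agree with `ℓ` only pointwise.
HalfBounded-cong : ∀ {r m} (G : Graph r m) {ℓ ℓ′ : Fin m → Maybe ℕ} → ℓ ≗ ℓ′ →
                   HalfBounded G ℓ → HalfBounded G ℓ′
HalfBounded-cong {r} {m} G {ℓ} {ℓ′} ℓ≗ℓ′ bounded w 0<w =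
  subst (_≤ ⌈ r /2⌉)
    (count-cong (weight G ℓ) (weight G ℓ′) w {allFin r}
      (All.universal (λ v → cong sum (mapMaybe-cong ℓ≗ℓ′ (filter (incident? G v) (allFin m)))) _))
    (bounded w 0<w)

update-isPartialLabeling : ∀ {m S} {ℓ : Fin m → Maybe ℕ} {e a} → IsPartialLabeling S ℓ →
  a ∈ S → a ∉ mapMaybe ℓ (allFin m) → IsPartialLabeling S (ℓ [ e ≔ a ])
update-isPartialLabeling {S = S} {ℓ} {e} {a} isℓ a∈S a-unused = record
  { fromS = fromS′ ; distinct = distinct′ }
  where
  open IsPartialLabeling isℓ

  at-or-off : ∀ {f b} → (ℓ [ e ≔ a ]) f ≡ just b → (f ≡ e × a ≡ b) ⊎ ℓ f ≡ just b
  at-or-off {f} eq with f Fin.≟ e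
  ... | yes refl = inj₁ (refl , just-injective (≡.trans (sym (updateAt-updates e ℓ)) eq))
  ... | no  f≢e  = inj₂ (≡.trans (sym (updateAt-minimal f e ℓ f≢e)) eq)

  fromS′ : ∀ {f b} → (ℓ [ e ≔ a ]) f ≡ just b → b ∈ S
  fromS′ eq with at-or-off eq
  ... | inj₁ (_ , refl) = a∈S
  ... | inj₂ old        = fromS old

  distinct′ : ∀ {f f′ b} → (ℓ [ e ≔ a ]) f ≡ just b → (ℓ [ e ≔ a ]) f′ ≡ just b → f ≡ f′
  distinct′ {f} {f′} eq eq′ with at-or-off eq | at-or-off eq′
  ... | inj₁ (refl , _) | inj₁ (refl , _) = refl
  -- An edge carrying the new label and one carrying the same label from before would make `a`
  -- already used.
  ... | inj₁ (_ , refl) | inj₂ old        = contradiction (∈-mapMaybe ℓ old (∈-allFin f′)) a-unused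
  ... | inj₂ old        | inj₁ (_ , refl) = contradiction (∈-mapMaybe ℓ old (∈-allFin f)) a-unused
  ... | inj₂ old        | inj₂ old′       = distinct old old′

-- Bounds on the number of vertices.

-- Excluding K₂ enters the proof here; the conclusion supplies 2 ≤ ⌈ r /2⌉, the bound that
-- `one-of-three` requires.
edge⇒3≤r : ∀ {r m} → Graph r m → NotK₂ r m → Fin m → 3 ≤ r
edge⇒3≤r {0} G _ e with () ← end₁ G e
edge⇒3≤r {1} G _ e with end₁ G e | end₂ G e | ordered G e
... | Fin.zero | Fin.zero | ()
edge⇒3≤r {2} {1} G notK₂ e = contradiction (refl , refl) notK₂
-- On two vertices all edges have the same ends, so the first two edges would be parallel.
edge⇒3≤r {2} {suc (suc m)} G notK₂ e =
  contradiction (simple G {Fin.zero} {Fin.suc Fin.zero}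
    (≡.trans (proj₁ (ends Fin.zero)) (sym (proj₁ (ends (Fin.suc Fin.zero)))))
    (≡.trans (proj₂ (ends Fin.zero)) (sym (proj₂ (ends (Fin.suc Fin.zero)))))) λ ()
  where
  ends : ∀ f → end₁ G f ≡ Fin.zero × end₂ G f ≡ Fin.suc Fin.zero
  ends f with end₁ G f | end₂ G f | ordered G f
  ... | Fin.zero         | Fin.suc Fin.zero | _       = refl , refl
  ... | Fin.suc Fin.zero | Fin.suc Fin.zero | s≤s ()
edge⇒3≤r {suc (suc (suc _))} _ _ _ = s≤s (s≤s (s≤s z≤n))

n≤⌈n/2⌉+⌈n/2⌉ : ∀ n → n ≤ ⌈ n /2⌉ + ⌈ n /2⌉
n≤⌈n/2⌉+⌈n/2⌉ n =
  subst (_≤ ⌈ n /2⌉ + ⌈ n /2⌉) (⌊n/2⌋+⌈n/2⌉≡n n) (+-monoˡ-≤ ⌈ n /2⌉ (⌊n/2⌋≤⌈n/2⌉ n))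

-- Completing the labeling edge by edge.

module _ {r m : ℕ} (G : Graph r m) (notK₂ : NotK₂ r m)
         {S : List ℕ} (isS : IsPositiveSet S (m + 2)) where

  open IsPositiveSet isS

  label-edge : ∀ {ℓ} e → ℓ e ≡ nothing → IsPartialLabeling S ℓ → HalfBounded G ℓ →
               ∃ λ a → IsPartialLabeling S (ℓ [ e ≔ a ]) × HalfBounded G (ℓ [ e ≔ a ])
  label-edge {ℓ} e ℓe isℓ bounded
    with extract (allFin⁺ r) (∈-allFin (end₁ G e))
  ... | L₁ , σ₁ , u∉L₁ , !L₁ with ∈-resp-↭ σ₁ (∈-allFin (end₂ G e))
  ...   | here v≡u = contradiction (sym v≡u) (Fin.<⇒≢ (ordered G e))
  ...   | there v∈L₁ with extract !L₁ v∈L₁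
  ...     | L , σ₂ , v∉L , _ with All-resp-↭ σ₂ u∉L₁
  ...       | _ ∷ u∉L = choose
    where
    used = mapMaybe ℓ (allFin m)

    raise : ℕ → Fin r → ℕ
    raise a = weight G (ℓ [ e ≔ a ])

    raise-other : ∀ a {x} → end₁ G e ≢ x → end₂ G e ≢ x → raise a x ≡ weight G ℓ x
    raise-other _ u≢x v≢x = weight-¬incident ℓ G λ where
      (inj₁ x≡u) → u≢x (sym x≡u)
      (inj₂ x≡v) → v≢x (sym x≡v)

    open Raise (trans σ₁ (prep _ σ₂)) u∉L v∉L (weight G ℓ) raise
      (λ _ → weight-incident ℓ G ℓe (inj₁ refl))
      (λ _ → weight-incident ℓ G ℓe (inj₂ refl))
      raise-other
      ⌈ r /2⌉
      (subst (_≤ ⌈ r /2⌉ + ⌈ r /2⌉) (sym (length-tabulate {n = r} (λ i → i))) (n≤⌈n/2⌉+⌈n/2⌉ r))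

    ∣used∣<m : length used < m
    ∣used∣<m = subst (length used <_) (length-tabulate {n = m} (λ i → i))
                     (length-mapMaybe-< ℓ ℓe (∈-allFin e))

    2+∣used∣<∣S∣ : 2 + length used < length S
    2+∣used∣<∣S∣ = subst (2 + length used <_) (≡.trans (+-comm 2 m) (sym cardinality))
                         (s≤s (s≤s ∣used∣<m))

    choose : ∃ λ a → IsPartialLabeling S (ℓ [ e ≔ a ]) × HalfBounded G (ℓ [ e ≔ a ])
    choose
      with a , a∈S , a∉ ← pigeonhole {ys = used} unique
                            (<-trans (n<1+n _) (<-trans (n<1+n _) 2+∣used∣<∣S∣))
      with b , b∈S , b∉ ← pigeonhole {ys = a ∷ used} unique (<-trans (n<1+n _) 2+∣used∣<∣S∣)
      with c , c∈S , c∉ ← pigeonhole {ys = b ∷ a ∷ used} unique 2+∣used∣<∣S∣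
      with one-of-three bounded (⌈n/2⌉-mono (edge⇒3≤r G notK₂ e)) a b c
             (λ a≡b → b∉ (here (sym a≡b)))
             (λ a≡c → c∉ (there (here (sym a≡c))))
             (λ b≡c → c∉ (here (sym b≡c)))
    ... | inj₁ ok        = a , update-isPartialLabeling isℓ a∈S a∉ , ok
    ... | inj₂ (inj₁ ok) = b , update-isPartialLabeling isℓ b∈S (b∉ ∘ there) , ok
    ... | inj₂ (inj₂ ok) = c , update-isPartialLabeling isℓ c∈S (c∉ ∘ there ∘ there) , ok

  -- Induction on a list `es` that covers all unlabeled edges. It may also contain labeled ones, so
  -- it can start as the list of all edges.
  complete : ∀ es {ℓ} → (∀ e → ℓ e ≡ nothing → e ∈ es) →
             IsPartialLabeling S ℓ → HalfBounded G ℓ →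
             Σ (Fin m → ℕ) λ c → IsCompletion S ℓ c × HalfBounded G (just ∘ c)
  complete [] {ℓ} unlabeled⊆ isℓ bounded = c , record
      { extends    = λ {e} ℓe → just-injective (≡.trans (sym (ℓ≗c e)) ℓe)
      ; isLabeling = record
        { fromS    = λ {e} ce → fromS (≡.trans (ℓ≗c e) ce)
        ; distinct = λ {e} {f} ce cf → distinct (≡.trans (ℓ≗c e) ce) (≡.trans (ℓ≗c f) cf)
        }
      } , HalfBounded-cong G ℓ≗c bounded
    where
    open IsPartialLabeling isℓ

    label : ∀ e → ∃ λ a → ℓ e ≡ just a
    label e with ℓ e in ℓe
    ... | just a  = a , refl
    -- With `es` empty no edge is unlabeled, so `ℓ` is already total.
    ... | nothing with () ← unlabeled⊆ e ℓe

    c : Fin m → ℕ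
    c = proj₁ ∘ label

    ℓ≗c : ℓ ≗ just ∘ c
    ℓ≗c = proj₂ ∘ label
  complete (e ∷ es) {ℓ} unlabeled⊆ isℓ bounded with ℓ e in ℓe
  ... | just a = complete es unlabeled⊆es isℓ bounded
    where
    unlabeled⊆es : ∀ f → ℓ f ≡ nothing → f ∈ es
    unlabeled⊆es f ℓf with unlabeled⊆ f ℓf
    ... | here refl  = contradiction (≡.trans (sym ℓf) ℓe) λ ()
    ... | there f∈es = f∈es
  ... | nothing with label-edge e ℓe isℓ bounded
  ...   | a , isℓ′ , bounded′ with complete es unlabeled⊆es isℓ′ bounded′
    where
    unlabeled⊆es : ∀ f → (ℓ [ e ≔ a ]) f ≡ nothing → f ∈ es
    unlabeled⊆es f ℓ′f with f Fin.≟ e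
    ... | yes refl = contradiction (≡.trans (sym (updateAt-updates e ℓ)) ℓ′f) λ ()
    ... | no  f≢e with unlabeled⊆ f (≡.trans (sym (updateAt-minimal f e ℓ f≢e)) ℓ′f)
    ...   | here f≡e   = contradiction f≡e f≢e
    ...   | there f∈es = f∈es
  ...     | c , isC , c-bounded = c , record
      -- An edge `f` labeled by `ℓ` differs from the unlabeled `e`, so the update keeps its label.
      { extends    = λ {f} ℓf → IsCompletion.extends isC
          (≡.trans (updateAt-minimal f e ℓ λ where
            refl → contradiction (≡.trans (sym ℓf) ℓe) λ ()) ℓf)
      ; isLabeling = IsCompletion.isLabeling isC
      } , c-bounded

lemma4p2 : ∀ (r m : ℕ) (G : Graph r m) → NotK₂ r m →
    (S : List ℕ) → IsPositiveSet S (m + 2) →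
    (ℓ : Fin m → Maybe ℕ) → IsPartialLabeling S ℓ → HalfBounded G ℓ →
    Σ (Fin m → ℕ) λ c → IsCompletion S ℓ c × HalfBounded G (just ∘ c)
lemma4p2 r m G notK₂ S isS ℓ isℓ bounded =
  complete G notK₂ isS (allFin m) (λ e _ → ∈-allFin e) isℓ bounded
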